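{- Let $D$ be a skeletal directed acyclic graph. The two maps $\rho_\vee$ and $I_\vee$ are inverse bijections between the join irreducibles of $\mathcal{AR}_D$ and the ropes of $D$. Likewise, the two maps $\rho_\wedge$ and $I_\wedge$ are inverse bijections between the meet irreducibles of $\mathcal{AR}_D$ and the ropes of $D$.
   Context: All directed graphs are finite and simple. A reorientation of a directed acyclic graph $D=(V,A)$ is a directed graph with the same underlying undirected graph, encoded by the set of arcs of $D$ that it reverses. $\mathcal{AR}_D$ is the poset of acyclic reorientations of $D$ ordered by inclusion of sets of reversed arcs. The transitive reduction of a directed acyclic graph is obtained by deleting all arcs whose endpoints are connected by a directed path of length at least $2$. A directed graph is a forest if its underlying undirected graph has no cycle. $D$ is vertebrate if the transitive reduction of every induced subgraph of $D$ is a forest; filled if for any directed path $\pi$ in $D$ whose endpoints are joined by an arc of $D$, all arcs joining any two vertices of $\pi$ belong to $D$; skeletal if vertebrate and filled. When $D$ is skeletal, $\mathcal{AR}_D$ is a lattice. An element of a lattice is join (resp. meet) irreducible if it covers (resp. is covered by) a unique element; $E\in\mathcal{AR}_D$ is join (resp. meet) irreducible if and only if exactly one arc of its transitive reduction is reversed (resp. not reversed) with respect to $D$. The transitive support of an arc $(u,v)$ of $D$ is the set of vertices appearing along directed paths in $D$ from $u$ to $v$. A rope of $D$ is a quadruple $(u,v,\nabla,\Delta)$ where $(u,v)\in A$ and $\nabla\sqcup\Delta$ is a partition of the transitive support of $(u,v)$ minus $\{u,v\}$. For an acyclic reorientation $E$ of $D$ and an arc $(u,v)$ of $D$, let $\nabla_{u,v}^E=\{w\in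 V : (u,w)\in D\setminus E,\ (w,v)\in D\cap E\}$, $\Delta_{u,v}^E=\{w\in V : (u,w)\in D\cap E,\ (w,v)\in D\setminus E\}$ (membership refers to arcs), and $\rho_{u,v}^E=(u,v,\nabla_{u,v}^E,\Delta_{u,v}^E)$. For a join (resp. meet) irreducible $I$ of $\mathcal{AR}_D$, let $\rho_\vee(I)$ (resp. $\rho_\wedge(I)$) be $\rho_{u,v}^I$ where $(u,v)$ is the only arc of $D$ that is reversed (resp. not reversed) in the transitive reduction of $I$. For a rope $\rho=(u,v,\nabla,\Delta)$, let $I_\vee(\rho)$ be the reorientation of $D$ where an arc $(w,w')$ of $D$ is reversed if and only if $w\in\Delta\cup\{u\}$ and $w'\in\nabla\cup\{v\}$; let $I_\wedge(\rho)$ be the reorientation of $D$ where an arc $(w,w')$ of $D$ is not reversed if and only if $w\in\nabla\cup\{u\}$ and $w'\in\Delta\cup\{v\}$. -}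

module Defs where

open import Data.Fin.Base using (Fin)
open import Data.Fin.Subset using (Subset; _∈_; _∩_; _∪_; ⁅_⁆; Empty)
open import Data.Fin.Subset.Properties using (_∈?_; ⊆-antisym)
open import Data.List.Base using (List; _∷_; _∷ʳ_; length)
import Data.List.Membership.Propositional as List
open import Data.List.Relation.Unary.AllPairs using (AllPairs)
open import Data.List.Relation.Unary.Linked using (Linked)
open import Data.List.Relation.Unary.Unique.Propositional using (Unique)
open import Data.Nat.Base using (ℕ; _≤_)
open import Data.Product.Base
  using (Σ-syntax; ∃₂; ∃-syntax; _×_; _,_; proj₁)
open import Data.Product using (∃!)
open import Data.Sum.Base using (_⊎_)
open import Data.Vec.Base using (Vec; lookup; tabulate)
import Data.Vec.Relation.Binary.Pointwise.Extensional as Pointwise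
open import Function.Base using (_∘_; id)
open import Function.Bundles using (Inverse; _⇔_)
open import Level using (Level; 0ℓ)
open import Relation.Binary.Bundles using (Poset; Setoid)
open import Relation.Binary.Core using (Rel)
open import Relation.Binary.Definitions using (Decidable)
import Relation.Binary.Construct.On as On
open import Relation.Binary.Construct.Closure.Symmetric using (SymClosure)
import Relation.Binary.Properties.Poset as PosetProperties
open import Relation.Binary.PropositionalEquality.Core using (_≡_; _≢_; refl)
open import Relation.Binary.PropositionalEquality.Properties
  using (isEquivalence; setoid)
open import Relation.Nullary.Decidable
  using (does; _×-dec_; _⊎-dec_; ¬?)
open import Relation.Nullary.Negation.Core using (¬_)
import Relation.Unary as U

------------------------------------------------------------------------
-- Paths, cycles and transitive reductions

module _ {n : ℕ} (R : Rel (Fin n) 0ℓ) where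

  -- A path is given by its endpoints u, v and the list xs of its interior
  -- vertices, so its length is 1 + length xs.  Vertices are not required
  -- to be distinct; this is automatic when R is acyclic.
  Path : Fin n → List (Fin n) → Fin n → Set
  Path u xs v = Linked R (u ∷ xs ∷ʳ v)

  -- The case xs = [] excludes loops and the case of a single interior
  -- vertex excludes pairs of opposite arcs, so acyclic digraphs are simple.
  Acyclic : Set
  Acyclic = ∀ u xs → ¬ Path u xs u

  TransitiveReduction : Rel (Fin n) 0ℓ
  TransitiveReduction u v = R u v × ¬ (∃₂ λ w ws → Path u (w ∷ ws) v)

  -- Vertices outside W are kept, but isolated.
  Induced : Subset n → Rel (Fin n) 0ℓ
  Induced W u v = u ∈ W × v ∈ W × R u v

  -- The length bound discards u - x - u, which traverses one edge twice.
  Forest : Set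
  Forest = ∀ u xs → 2 ≤ length xs → Unique (u ∷ xs) →
           ¬ Linked (SymClosure R) (u ∷ xs ∷ʳ u)

module _ {n : ℕ} (R : Rel (Fin n) 0ℓ) where

  Vertebrate : Set
  Vertebrate = ∀ (W : Subset n) → Forest (TransitiveReduction (Induced R W))

  -- AllPairs R relates each vertex of the path to all later ones; when R is
  -- acyclic, arcs between vertices of a path can only go in that direction.
  Filled : Set
  Filled = ∀ u xs v → Path R u xs v → R u v → AllPairs R (u ∷ xs ∷ʳ v)

  Skeletal : Set
  Skeletal = Vertebrate × Filled

  TransitiveSupport : Fin n → Fin n → U.Pred (Fin n) 0ℓ
  TransitiveSupport u v w =
    ∃[ xs ] Path R u xs v × w List.∈ (u ∷ xs ∷ʳ v)

------------------------------------------------------------------------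
-- Covers and irreducible elements of a poset

module _ {c ℓ₁ ℓ₂ : Level} (P : Poset c ℓ₁ ℓ₂) where
  open Poset P using (Carrier; _≈_)
  open PosetProperties P using (_<_)

  Covers : Rel Carrier _
  Covers x y = y < x × ¬ (∃[ z ] y < z × z < x)

  JoinIrreducible : U.Pred Carrier _
  JoinIrreducible x = ∃! _≈_ (λ y → Covers x y)

  MeetIrreducible : U.Pred Carrier _
  MeetIrreducible x = ∃! _≈_ (λ y → Covers y x)

------------------------------------------------------------------------
-- Sets of arcs

-- The u-th entry is the set of the heads of the arcs with tail u.
ArcSet : ℕ → Set
ArcSet n = Vec (Subset n) n

Digraph : ℕ → Set
Digraph = ArcSet

subset : ∀ {n} {P : U.Pred (Fin n) 0ℓ} → U.Decidable P → Subset n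
subset P? = tabulate (λ u → does (P? u))

arcSet : ∀ {n} {R : Rel (Fin n) 0ℓ} → Decidable R → ArcSet n
arcSet R? = tabulate (λ u → subset (R? u))

module _ {n : ℕ} where

  infix 4 _∋_⟶_ _∋_⟶?_ _⊆ᵃ_

  _∋_⟶_ : ArcSet n → Rel (Fin n) 0ℓ
  S ∋ u ⟶ v = v ∈ lookup S u

  _∋_⟶?_ : (S : ArcSet n) → Decidable (S ∋_⟶_)
  S ∋ u ⟶? v = v ∈? lookup S u

  _⊆ᵃ_ : Rel (ArcSet n) 0ℓ
  S ⊆ᵃ T = ∀ {u v} → S ∋ u ⟶ v → T ∋ u ⟶ v

⊆ᵃ-poset : ℕ → Poset 0ℓ 0ℓ 0ℓ
⊆ᵃ-poset n = record
  { Carrier        = ArcSet n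
  ; _≈_            = _≡_
  ; _≤_            = _⊆ᵃ_
  ; isPartialOrder = record
    { isPreorder = record
      { isEquivalence = isEquivalence
      ; reflexive     = λ { refl → id }
      ; trans         = λ S⊆T T⊆U → T⊆U ∘ S⊆T
      }
    ; antisym = λ S⊆T T⊆S → Pointwise.Pointwise-≡⇒≡
        (Pointwise.ext λ _ → ⊆-antisym S⊆T T⊆S)
    }
  }

------------------------------------------------------------------------
-- Acyclic reorientations

module _ {n : ℕ} (D : Digraph n) where

  -- The arcs of the reorientation of D that reverses the arcs in E.
  Reoriented : ArcSet n → Rel (Fin n) 0ℓ
  Reoriented E u v = (D ∋ u ⟶ v × ¬ E ∋ u ⟶ v)
                   ⊎ (D ∋ v ⟶ u × E ∋ v ⟶ u)

  reoriented? : ∀ E → Decidable (Reoriented E)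
  reoriented? E u v = ((D ∋ u ⟶? v) ×-dec ¬? (E ∋ u ⟶? v))
               ⊎-dec ((D ∋ v ⟶? u) ×-dec (E ∋ v ⟶? u))

  record AcyclicReorientation : Set where
    field
      reversed   : ArcSet n
      reversed⊆D : reversed ⊆ᵃ D
      acyclic    : Acyclic (Reoriented reversed)

  open AcyclicReorientation

  AR : Poset 0ℓ 0ℓ 0ℓ
  AR = On.poset (⊆ᵃ-poset n) reversed

  JoinIrreducibles : Setoid 0ℓ 0ℓ
  JoinIrreducibles =
    On.setoid (Poset.Eq.setoid AR) (proj₁ {B = JoinIrreducible AR})

  MeetIrreducibles : Setoid 0ℓ 0ℓ
  MeetIrreducibles =
    On.setoid (Poset.Eq.setoid AR) (proj₁ {B = MeetIrreducible AR})

------------------------------------------------------------------------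
-- Ropes

Quadruple : ℕ → Set
Quadruple n = Fin n × Fin n × Subset n × Subset n

module _ {n : ℕ} (D : Digraph n) where
  open AcyclicReorientation

  IsRope : U.Pred (Quadruple n) 0ℓ
  IsRope (u , v , ∇ , Δ) =
    D ∋ u ⟶ v ×
    Empty (∇ ∩ Δ) ×
    (∀ w → w ∈ ∇ ∪ Δ ⇔
           (TransitiveSupport (D ∋_⟶_) u v w × w ≢ u × w ≢ v))

  Ropes : Setoid 0ℓ 0ℓ
  Ropes = On.setoid (setoid (Quadruple n)) (proj₁ {B = IsRope})

  -- Here D and the reorientation are regarded as sets of arcs: the arcs of
  -- D that are not arcs of the reorientation are the reversed ones.
  module _ (E : ArcSet n) where

    InDifference : Rel (Fin n) 0ℓ
    InDifference u v = D ∋ u ⟶ v × ¬ Reoriented D E u v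

    InIntersection : Rel (Fin n) 0ℓ
    InIntersection u v = D ∋ u ⟶ v × Reoriented D E u v

    inDifference? : Decidable InDifference
    inDifference? u v = (D ∋ u ⟶? v) ×-dec ¬? (reoriented? D E u v)

    inIntersection? : Decidable InIntersection
    inIntersection? u v = (D ∋ u ⟶? v) ×-dec reoriented? D E u v

    ∇⟨_,_⟩ : Fin n → Fin n → Subset n
    ∇⟨ u , v ⟩ = subset λ w → inDifference? u w ×-dec inIntersection? w v

    Δ⟨_,_⟩ : Fin n → Fin n → Subset n
    Δ⟨ u , v ⟩ = subset λ w → inIntersection? u w ×-dec inDifference? w v

    ρ⟨_,_⟩ : Fin n → Fin n → Quadruple n
    ρ⟨ u , v ⟩ = u , v , ∇⟨ u , v ⟩ , Δ⟨ u , v ⟩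

    -- (u , v) is an arc of D whose reverse (resp. which itself) belongs to
    -- the transitive reduction of the reorientation.
    ReversedInReduction : U.Pred (Fin n × Fin n) 0ℓ
    ReversedInReduction (u , v) =
      D ∋ u ⟶ v × TransitiveReduction (Reoriented D E) v u

    UnreversedInReduction : U.Pred (Fin n × Fin n) 0ℓ
    UnreversedInReduction (u , v) =
      D ∋ u ⟶ v × TransitiveReduction (Reoriented D E) u v

    ρ∨ : ∃! _≡_ ReversedInReduction → Quadruple n
    ρ∨ ((u , v) , _) = ρ⟨ u , v ⟩

    ρ∧ : ∃! _≡_ UnreversedInReduction → Quadruple n
    ρ∧ ((u , v) , _) = ρ⟨ u , v ⟩

  -- The sets of arcs reversed in the reorientations associated to a rope.
  I∨ : Quadruple n → ArcSet n
  I∨ (u , v , ∇ , Δ) = arcSet λ w w′ →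
    (D ∋ w ⟶? w′) ×-dec ((w ∈? Δ ∪ ⁅ u ⁆) ×-dec (w′ ∈? ∇ ∪ ⁅ v ⁆))

  I∧ : Quadruple n → ArcSet n
  I∧ (u , v , ∇ , Δ) = arcSet λ w w′ →
    (D ∋ w ⟶? w′) ×-dec ¬? ((w ∈? ∇ ∪ ⁅ u ⁆) ×-dec (w′ ∈? Δ ∪ ⁅ v ⁆))

  -- f is given by ρ∨ (which is defined on every join irreducible, and whose
  -- values are ropes) and its inverse by I∨ (whose values are join
  -- irreducible).
  GivenBy-ρ∨-I∨ : Inverse (JoinIrreducibles D) Ropes → Set
  GivenBy-ρ∨-I∨ f =
    (∀ I → Σ[ arc ∈ ∃! _≡_ (ReversedInReduction (reversed (proj₁ I))) ]
             proj₁ (Inverse.to f I) ≡ ρ∨ (reversed (proj₁ I)) arc) ×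
    (∀ ρ → reversed (proj₁ (Inverse.from f ρ)) ≡ I∨ (proj₁ ρ))

  GivenBy-ρ∧-I∧ : Inverse (MeetIrreducibles D) Ropes → Set
  GivenBy-ρ∧-I∧ f =
    (∀ I → Σ[ arc ∈ ∃! _≡_ (UnreversedInReduction (reversed (proj₁ I))) ]
             proj₁ (Inverse.to f I) ≡ ρ∧ (reversed (proj₁ I)) arc) ×
    (∀ ρ → reversed (proj₁ (Inverse.from f ρ)) ≡ I∧ (proj₁ ρ))

{-# OPTIONS --safe #-}
module Submission where

-- Turning around an arc of the transitive reduction never creates a cycle, and
-- if F lies strictly below E then they differ on an arc of the reduction of E.
-- So the elements covered by E are the E ∖ e, where e is a reversed arc in the
-- reduction of E, and E is join irreducible when there is exactly one such e.
-- For a rope (u , v , ∇ , Δ) a path of D from Δ ∪ {u} to ∇ ∪ {v} extends to a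
-- path from u to v, hence contains an arc reversed in I∨: every path of I∨ has
-- at most one reversed arc.  The meet case is the join case for E ↦ D ∖ E,
-- which turns all arcs around and exchanges ∇ and Δ.

open import Defs
import Data.Bool.Properties as Bool
open import Data.Empty using (⊥-elim)
open import Data.Fin.Base using (Fin)
open import Data.Fin.Induction using (spo-wellFounded; spo-noetherian)
open import Data.Fin.Properties using (_≟_; any?)
open import Data.Fin.Subset using (Subset; _∈_; _∩_; _∪_; ⁅_⁆; Empty)
open import Data.Fin.Subset.Properties
  using (_∈?_; ⊆-antisym; ∩-comm; ∪-comm; x∈p∩q⁺; x∈p∩q⁻; x∈p∪q⁺; x∈p∪q⁻; x∈⁅x⁆; x∈⁅y⁆⇒x≡y)
open import Data.List.Base using ([]; _∷_; _∷ʳ_)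
import Data.List.Membership.Propositional as List
open import Data.List.Relation.Unary.All as All using ()
open import Data.List.Relation.Unary.AllPairs using (AllPairs; _∷_)
open import Data.List.Relation.Unary.Any using (here; there)
open import Data.List.Relation.Unary.Linked using ([-]; _∷_)
open import Data.Nat.Base using (ℕ)
open import Data.Product.Base using (Σ; Σ-syntax; ∃-syntax; _×_; _,_; proj₁; proj₂)
open import Data.Product using (∃!)
open import Data.Sum.Base as Sum using (_⊎_; inj₁; inj₂)
open import Data.Vec.Properties
  using (lookup∘tabulate; lookup⇒[]=; []=⇒lookup; ≡-dec)
open import Function.Base using (flip; _∘_; case_of_)
open import Function.Bundles using (Inverse; _⇔_; mk⇔; Equivalence)
import Function.Construct.Composition as Composition
open import Induction.WellFounded using (Acc; acc; WellFounded)
open import Level using (0ℓ)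
open import Relation.Binary.Bundles using (Poset)
open import Relation.Binary.Core using (Rel)
open import Relation.Binary.Construct.Closure.ReflexiveTransitive
  using (Star; ε; _◅_; _◅◅_)
import Relation.Binary.Construct.Closure.ReflexiveTransitive as Star
open import Relation.Binary.Construct.Closure.Transitive as ⁺
  using (TransClosure; [_]; _∷_)
open import Relation.Binary.Definitions using (Decidable)
import Relation.Binary.Properties.Poset as PosetProperties
open import Relation.Binary.PropositionalEquality
  using (_≡_; _≢_; refl; sym; trans; cong; cong₂; subst; isEquivalence; resp₂)
open import Relation.Binary.Structures using (IsStrictPartialOrder)
open import Relation.Nullary.Decidable
  using (Dec; yes; no; does; dec-true; _×-dec_; _⊎-dec_; ¬?; map′; decidable-stable)
open import Relation.Nullary.Negation.Core using (¬_; contradiction)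
import Relation.Unary as U

open Equivalence using () renaming (to to ⇔-to; from to ⇔-from)

-- Transitive closures, paths and reductions.

module _ {A : Set} {R : Rel A 0ℓ} where

  ⁺⇒* : ∀ {x y} → TransClosure R x y → Star R x y
  ⁺⇒* [ r ]   = r ◅ ε
  ⁺⇒* (r ∷ p) = r ◅ ⁺⇒* p

  infixr 5 _◅⁺_ _◅◅⁺_ _⁺◅◅_

  _◅⁺_ : ∀ {x y z} → R x y → Star R y z → TransClosure R x z
  r ◅⁺ ε       = [ r ]
  r ◅⁺ (s ◅ p) = r ∷ (s ◅⁺ p)

  _◅◅⁺_ : ∀ {x y z} → Star R x y → TransClosure R y z → TransClosure R x z
  ε       ◅◅⁺ q = q
  (r ◅ p) ◅◅⁺ q = r ∷ (p ◅◅⁺ q)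

  _⁺◅◅_ : ∀ {x y z} → TransClosure R x y → Star R y z → TransClosure R x z
  [ r ]   ⁺◅◅ q = r ◅⁺ q
  (r ∷ p) ⁺◅◅ q = r ∷ (p ⁺◅◅ q)

  *⇒≡⊎⁺ : ∀ {x y} → Star R x y → x ≡ y ⊎ TransClosure R x y
  *⇒≡⊎⁺ ε       = inj₁ refl
  *⇒≡⊎⁺ (r ◅ p) = inj₂ (r ◅⁺ p)

module _ {A : Set} {R S : Rel A 0ℓ} where

  ⁺-map : (∀ {x y} → R x y → S x y) →
          ∀ {x y} → TransClosure R x y → TransClosure S x y
  ⁺-map f [ r ]   = [ f r ]
  ⁺-map f (r ∷ p) = f r ∷ ⁺-map f p

  ⁺-reverse : (∀ {x y} → R x y → S y x) →
              ∀ {x y} → TransClosure R x y → TransClosure S y x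
  ⁺-reverse f [ r ]   = [ f r ]
  ⁺-reverse f (r ∷ p) = ⁺-reverse f p ⁺.∷ʳ f r

  ⁺-split : (∀ {x y} → R x y → Dec (S x y)) →
            ∀ {x y} → TransClosure R x y →
            TransClosure S x y ⊎ ∃[ a ] ∃[ b ] R a b × ¬ S a b
  ⁺-split S? [ r ] with S? r
  ... | yes s = inj₁ [ s ]
  ... | no ¬s = inj₂ (_ , _ , r , ¬s)
  ⁺-split S? (r ∷ p) with S? r
  ... | yes s = Sum.map₁ (s ∷_) (⁺-split S? p)
  ... | no ¬s = inj₂ (_ , _ , r , ¬s)

  -- A path using a distinguished arc (u , v) is cut at the first and at the
  -- last use of it.
  detour : ∀ {u v} → (∀ {x y} → R x y → S x y ⊎ (x ≡ u × y ≡ v)) →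
           ∀ {x y} → TransClosure R x y →
           TransClosure S x y ⊎ (Star S x u × Star S v y)
  detour classify [ r ] with classify r
  ... | inj₁ s             = inj₁ [ s ]
  ... | inj₂ (refl , refl) = inj₂ (ε , ε)
  detour classify (r ∷ p) with classify r | detour classify p
  ... | inj₁ s             | inj₁ q       = inj₁ (s ∷ q)
  ... | inj₁ s             | inj₂ (q , t) = inj₂ (s ◅ q , t)
  ... | inj₂ (refl , refl) | inj₁ q       = inj₂ (ε , ⁺⇒* q)
  ... | inj₂ (refl , refl) | inj₂ (_ , t) = inj₂ (ε , t)

module _ {n : ℕ} {R : Rel (Fin n) 0ℓ} where

  path⇒⁺ : ∀ {u v} xs → Path R u xs v → TransClosure R u v
  path⇒⁺ []       (r ∷ [-]) = [ r ]
  path⇒⁺ (x ∷ xs) (r ∷ p)   = r ∷ path⇒⁺ xs p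

  ⁺⇒path : ∀ {u v} → TransClosure R u v → ∃[ xs ] Path R u xs v
  ⁺⇒path [ r ]   = [] , r ∷ [-]
  ⁺⇒path (r ∷ p) = let xs , q = ⁺⇒path p in _ ∷ xs , r ∷ q

  acyclic⇒irrefl⁺ : Acyclic R → ∀ {x} → ¬ TransClosure R x x
  acyclic⇒irrefl⁺ acyclic p = let xs , q = ⁺⇒path p in acyclic _ xs q

  irrefl⁺⇒acyclic : (∀ {x} → ¬ TransClosure R x x) → Acyclic R
  irrefl⁺⇒acyclic irrefl _ xs p = irrefl (path⇒⁺ xs p)

  -- Once all arcs of the first path but its initial one are moved to the second path, the
  -- concatenation visibly has length at least 2, which the definition forbids. Membership in a
  -- reduction is used in this form from here on.
  reduction-indecomposable : ∀ {u v w} → TransitiveReduction R u v →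
    TransClosure R u w → ¬ TransClosure R w v
  reduction-indecomposable (_ , ¬path) [ r ] q =
    let xs , q′ = ⁺⇒path q in ¬path (_ , xs , r ∷ q′)
  reduction-indecomposable t (r ∷ p) q =
    reduction-indecomposable t [ r ] (p ⁺.++ q)

  indecomposable⇒reduction : ∀ {u v} → R u v →
    (∀ {w} → R u w → ¬ TransClosure R w v) → TransitiveReduction R u v
  indecomposable⇒reduction r ¬split =
    r , λ { (_ , ws , s ∷ p) → ¬split s (path⇒⁺ ws p) }

  path-through : ∀ {u v w} → TransClosure R u w → TransClosure R w v →
                 ∃[ xs ] Path R u xs v × w List.∈ xs
  path-through [ r ] q = let xs , q′ = ⁺⇒path q in _ ∷ xs , r ∷ q′ , here refl
  path-through (r ∷ p) q =
    let xs , q′ , w∈xs = path-through p q in _ ∷ xs , r ∷ q′ , there w∈xs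

  path-prefix : ∀ {u v w} xs → Path R u xs v → w List.∈ xs → TransClosure R u w
  path-prefix (x ∷ xs) (r ∷ p) (here refl) = [ r ]
  path-prefix (x ∷ xs) (r ∷ p) (there w∈)  = r ∷ path-prefix xs p w∈

  path-suffix : ∀ {u v w} xs → Path R u xs v → w List.∈ xs → TransClosure R w v
  path-suffix (x ∷ xs) (r ∷ p) (here refl) = path⇒⁺ xs p
  path-suffix (x ∷ xs) (r ∷ p) (there w∈)  = path-suffix xs p w∈

interior⁺ : ∀ {A : Set} {w v : A} xs → w List.∈ xs → w List.∈ (xs ∷ʳ v)
interior⁺ (x ∷ xs) (here refl) = here refl
interior⁺ (x ∷ xs) (there w∈)  = there (interior⁺ xs w∈)

interior⁻ : ∀ {A : Set} {w v : A} xs → w List.∈ (xs ∷ʳ v) → w ≢ v → w List.∈ xs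
interior⁻ []       (here w≡v)  w≢v = contradiction w≡v w≢v
interior⁻ (x ∷ xs) (here refl) w≢v = here refl
interior⁻ (x ∷ xs) (there w∈)  w≢v = there (interior⁻ xs w∈ w≢v)

allPairs-last : ∀ {A : Set} {R : Rel A 0ℓ} {v w : A} xs →
                AllPairs R (xs ∷ʳ v) → w List.∈ xs → R w v
allPairs-last (x ∷ xs) (rs ∷ _)   (here refl) = All.lookup rs (last∈ xs)
  where
  last∈ : ∀ {A : Set} {v : A} xs → v List.∈ (xs ∷ʳ v)
  last∈ []       = here refl
  last∈ (x ∷ xs) = there (last∈ xs)
allPairs-last (x ∷ xs) (_  ∷ rss) (there w∈)  = allPairs-last xs rss w∈

-- Reachability and transitive reduction of a finite acyclic relation.

module AcyclicRelation {n : ℕ} {R : Rel (Fin n) 0ℓ} (R? : Decidable R)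
                       (irrefl⁺ : ∀ {x} → ¬ TransClosure R x x) where

  ⁺-isStrictPartialOrder : IsStrictPartialOrder _≡_ (TransClosure R)
  ⁺-isStrictPartialOrder = record
    { isEquivalence = isEquivalence
    ; irrefl        = λ { refl → irrefl⁺ }
    ; trans         = ⁺._++_
    ; <-resp-≈      = resp₂ _
    }

  private
    wellFounded : WellFounded (TransClosure R)
    wellFounded = spo-wellFounded ⁺-isStrictPartialOrder

    noetherian : WellFounded (flip (TransClosure R))
    noetherian = spo-noetherian ⁺-isStrictPartialOrder

  -- A search through the successors of `x`, which terminates because paths of a finite acyclic
  -- relation cannot ascend forever. It is needed to decide whether an arc belongs to the reduction.
  ⁺? : Decidable (TransClosure R)
  ⁺? x y = go (noetherian x)
    where
    go : ∀ {x} → Acc (flip (TransClosure R)) x → Dec (TransClosure R x y)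
    go {x} (acc rec) = map′ join split (any? via?)
      where
      Via : U.Pred (Fin n) 0ℓ
      Via w = R x w × (w ≡ y ⊎ TransClosure R w y)

      via? : U.Decidable Via
      via? w with R? x w
      ... | no ¬r = no (¬r ∘ proj₁)
      ... | yes r = map′ (r ,_) proj₂ ((w ≟ y) ⊎-dec go (rec [ r ]))

      join : ∃[ w ] Via w → TransClosure R x y
      join (_ , r , inj₁ refl) = [ r ]
      join (_ , r , inj₂ p)    = r ∷ p

      split : TransClosure R x y → ∃[ w ] Via w
      split [ r ]   = _ , r , inj₁ refl
      split (r ∷ p) = _ , r , inj₂ p

  reduced⊎decomposable : ∀ {u v} → R u v →
    TransitiveReduction R u v ⊎ ∃[ w ] R u w × TransClosure R w v
  reduced⊎decomposable {u} {v} r with any? (λ w → R? u w ×-dec ⁺? w v)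
  ... | yes split = inj₂ split
  ... | no ¬split =
    inj₁ (indecomposable⇒reduction r λ s p → ¬split (_ , s , p))

  -- Two nested inductions. As long as the first arc decomposes, it is replaced by an arc from `x`
  -- to an earlier vertex, so its head descends; once it is reduced it is kept, and the starting
  -- point ascends to its head.
  refine : ∀ {x y} → TransClosure R x y → TransClosure (TransitiveReduction R) x y
  refine {x} = go (noetherian x)
    where
    go : ∀ {x y} → Acc (flip (TransClosure R)) x →
         TransClosure R x y → TransClosure (TransitiveReduction R) x y
    go {x} {y} (acc rec) = λ where
        [ r ]   → first (wellFounded _) r (inj₁ refl)
        (r ∷ p) → first (wellFounded _) r (inj₂ p)
      where
      -- The remainder after the first arc may be empty; what is left of a decomposed arc is
      -- prepended to it.
      first : ∀ {w} → Acc (TransClosure R) w → R x w → w ≡ y ⊎ TransClosure R w y →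
              TransClosure (TransitiveReduction R) x y
      first (acc rec′) r rest with reduced⊎decomposable r | rest
      ... | inj₁ t | inj₁ refl = [ t ]
      ... | inj₁ t | inj₂ p    = t ∷ go (rec [ r ]) p
      ... | inj₂ (_ , s , q) | inj₁ refl = first (rec′ q) s (inj₂ q)
      ... | inj₂ (_ , s , q) | inj₂ p    = first (rec′ q) s (inj₂ (q ⁺.++ p))

-- Membership and extensionality for subsets and arc sets.

module _ {n : ℕ} {P : U.Pred (Fin n) 0ℓ} (P? : U.Decidable P) where

  ∈-subset : ∀ {w} → w ∈ subset P? ⇔ P w
  ∈-subset {w} = mk⇔ to from
    where
    to : w ∈ subset P? → P w
    -- Abstracting the equation together with the decision turns it into `false ≡ true` in the
    -- negative case, which therefore has no clause.
    to w∈ with P? w | trans (sym (lookup∘tabulate (does ∘ P?) w)) ([]=⇒lookup w∈)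
    ... | yes p | _ = p

    from : P w → w ∈ subset P?
    from p = lookup⇒[]= w _ (trans (lookup∘tabulate (does ∘ P?) w) (dec-true (P? w) p))

module _ {n : ℕ} {R : Rel (Fin n) 0ℓ} (R? : Decidable R) where

  ∈-arcSet : ∀ {u v} → arcSet R? ∋ u ⟶ v ⇔ R u v
  ∈-arcSet {u} {v} =
    subst (λ S → v ∈ S ⇔ R u v) (sym (lookup∘tabulate (subset ∘ R?) u)) (∈-subset (R? u))

subset-ext : ∀ {n} {S T : Subset n} → (∀ {w} → w ∈ S ⇔ w ∈ T) → S ≡ T
subset-ext S⇔T = ⊆-antisym (⇔-to S⇔T) (⇔-from S⇔T)

arcSet-ext : ∀ {n} {S T : ArcSet n} →
             (∀ {u v} → S ∋ u ⟶ v → T ∋ u ⟶ v) →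
             (∀ {u v} → T ∋ u ⟶ v → S ∋ u ⟶ v) → S ≡ T
arcSet-ext {n} {S} {T} S⊆T T⊆S =
  Poset.antisym (⊆ᵃ-poset n) {S} {T} S⊆T T⊆S

∈-∪⁅⁆ : ∀ {n} {S : Subset n} {u w} → w ∈ S ∪ ⁅ u ⁆ ⇔ (w ∈ S ⊎ w ≡ u)
∈-∪⁅⁆ {S = S} {u} = mk⇔
  (Sum.map₂ (x∈⁅y⁆⇒x≡y u) ∘ x∈p∪q⁻ S ⁅ u ⁆)
  (x∈p∪q⁺ ∘ Sum.map₂ λ { refl → x∈⁅x⁆ u })

transitiveReduction-reverse : ∀ {n} {R S : Rel (Fin n) 0ℓ} →
  (∀ {x y} → R x y ⇔ S y x) →
  ∀ {u v} → TransitiveReduction R u v → TransitiveReduction S v u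
transitiveReduction-reverse R⇔S t = indecomposable⇒reduction (⇔-to R⇔S (proj₁ t)) λ s p →
  reduction-indecomposable t (⁺-reverse (⇔-from R⇔S) p) [ ⇔-from R⇔S s ]

-- Antitone involutions exchange join and meet irreducibles.

module AntitoneInvolution {c ℓ₁ ℓ₂} (P : Poset c ℓ₁ ℓ₂)
  (f : Poset.Carrier P → Poset.Carrier P)
  (antitone : ∀ {x y} → Poset._≤_ P x y → Poset._≤_ P (f y) (f x))
  (involutive : ∀ x → Poset._≈_ P (f (f x)) x) where

  open Poset P
  open PosetProperties P using (_<_; <-respˡ-≈; <-respʳ-≈)

  f-cong : ∀ {x y} → x ≈ y → f x ≈ f y
  f-cong x≈y = antisym (antitone (reflexive (Eq.sym x≈y))) (antitone (reflexive x≈y))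

  <-antitone : ∀ {x y} → x < y → f y < f x
  <-antitone (x≤y , x≉y) = antitone x≤y , λ fy≈fx →
    x≉y (Eq.trans (Eq.sym (involutive _)) (Eq.trans (f-cong (Eq.sym fy≈fx)) (involutive _)))

  covers-antitone : ∀ {x y} → Covers P y x → Covers P (f x) (f y)
  covers-antitone (x<y , ¬between) = <-antitone x<y , λ (z , fy<z , z<fx) →
    ¬between ( f z
             , <-respˡ-≈ (involutive _) (<-antitone z<fx)
             , <-respʳ-≈ (involutive _) (<-antitone fy<z) )

  covers-respˡ-≈ : ∀ {x y z} → x ≈ y → Covers P x z → Covers P y z
  covers-respˡ-≈ x≈y (z<x , ¬between) = <-respʳ-≈ x≈y z<x , λ (w , z<w , w<y) →
    ¬between (w , z<w , <-respʳ-≈ (Eq.sym x≈y) w<y)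

  covers-respʳ-≈ : ∀ {x y z} → x ≈ y → Covers P z x → Covers P z y
  covers-respʳ-≈ x≈y (x<z , ¬between) = <-respˡ-≈ x≈y x<z , λ (w , y<w , w<z) →
    ¬between (w , <-respˡ-≈ (Eq.sym x≈y) y<w , w<z)

  -- An element covered by `f x` is sent by `f` to one covering `f (f x) ≈ x`, hence to the unique
  -- such element; applying `f` again determines the original one.
  meet⇒joinIrreducible : ∀ {x} → MeetIrreducible P x → JoinIrreducible P (f x)
  meet⇒joinIrreducible (y , covers , unique) = f y , covers-antitone covers , λ covers′ →
    Eq.trans (f-cong (unique (covers-respʳ-≈ (involutive _) (covers-antitone covers′))))
             (involutive _)

  join⇒meetIrreducible : ∀ {x} → JoinIrreducible P x → MeetIrreducible P (f x)
  join⇒meetIrreducible (y , covers , unique) = f y , covers-antitone covers , λ covers′ →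
    Eq.trans (f-cong (unique (covers-respˡ-≈ (involutive _) (covers-antitone covers′))))
             (involutive _)

-- Kept arcs, and removal of one arc from a set of reversed arcs.

module AcyclicReorientations {n : ℕ} (D : Digraph n) (D-acyclic : Acyclic (D ∋_⟶_)) where

  open AcyclicReorientation

  D⁺ : Rel (Fin n) 0ℓ
  D⁺ = TransClosure (D ∋_⟶_)

  D-irrefl⁺ : ∀ {u} → ¬ D⁺ u u
  D-irrefl⁺ = acyclic⇒irrefl⁺ D-acyclic

  D-asym : ∀ {u v} → D ∋ u ⟶ v → ¬ D ∋ v ⟶ u
  D-asym uv vu = D-irrefl⁺ (uv ∷ [ vu ])

  Kept : ArcSet n → Rel (Fin n) 0ℓ
  Kept E u v = D ∋ u ⟶ v × ¬ E ∋ u ⟶ v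

  kept⁺⇒D⁺ : ∀ {E u v} → TransClosure (Kept E) u v → D⁺ u v
  kept⁺⇒D⁺ = ⁺-map proj₁


  _∖_ : ArcSet n → Fin n × Fin n → ArcSet n
  E ∖ (u , v) = arcSet λ a b → (E ∋ a ⟶? b) ×-dec ¬? ((a ≟ u) ×-dec (b ≟ v))

  ∈-∖ : ∀ {E u v a b} → (E ∖ (u , v)) ∋ a ⟶ b ⇔ (E ∋ a ⟶ b × ¬ (a ≡ u × b ≡ v))
  ∈-∖ {E} {u} {v} = ∈-arcSet λ a b → (E ∋ a ⟶? b) ×-dec ¬? ((a ≟ u) ×-dec (b ≟ v))

  ∖-⊆ : ∀ {E e} → (E ∖ e) ⊆ᵃ E
  ∖-⊆ {E} {e} ab = proj₁ (⇔-to (∈-∖ {E} {proj₁ e} {proj₂ e}) ab)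

  -- The arc `(u , v)` of `E` is missing on the left; on the right it can only be missing as `e`
  -- itself.
  ∖-injective : ∀ {E u v e} → E ∋ u ⟶ v → E ∖ (u , v) ≡ E ∖ e → (u , v) ≡ e
  ∖-injective {E} {u} {v} {a , b} uv eq with (u ≟ a) ×-dec (v ≟ b)
  ... | yes (refl , refl) = refl
  ... | no uv≢ab = contradiction (refl , refl)
    (proj₂ (⇔-to (∈-∖ {E}) (subst (_∋ u ⟶ v) (sym eq) (⇔-from (∈-∖ {E}) (uv , uv≢ab)))))

  -- Elements covered by a reorientation, and join irreducibility.

  module Irreducibility (I : AcyclicReorientation D) where

    private
      E = reversed I

    irrefl⁺ : ∀ {u} → ¬ TransClosure (Reoriented D E) u u
    irrefl⁺ = acyclic⇒irrefl⁺ (acyclic I)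

    open AcyclicRelation (reoriented? D E) irrefl⁺ public using (refine)

    reversedInReduction⇒∈ : ∀ {u v} → ReversedInReduction D E (u , v) → E ∋ u ⟶ v
    reversedInReduction⇒∈ (_  , inj₂ (_ , uv) , _) = uv
    reversedInReduction⇒∈ (uv , inj₁ (vu , _) , _) = contradiction vu (D-asym uv)

    -- A new cycle has to use the restored arc `u ⟶ v`. Cutting at its first and last use leaves a
    -- path from `v` to `u` made of other arcs of `E`. As `v ⟶ u` itself is excluded from `Other`,
    -- this path has length at least 2, so `v ⟶ u` was not in the reduction.
    restore-irrefl⁺ : ∀ {e} → ReversedInReduction D E e →
                      ∀ {x} → ¬ TransClosure (Reoriented D (E ∖ e)) x x
    restore-irrefl⁺ {u , v} (uv , reduced) p = case detour classify p of λ where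
        (inj₁ q)       → irrefl⁺ (⁺-map proj₁ q)
        (inj₂ (q , t)) → no-detour (t ◅◅ q)
      where
      Other : Rel (Fin n) 0ℓ
      Other a b = Reoriented D E a b × ¬ (a ≡ v × b ≡ u)

      classify : ∀ {a b} → Reoriented D (E ∖ (u , v)) a b → Other a b ⊎ (a ≡ u × b ≡ v)
      classify {a} {b} (inj₁ (ab , ab∉)) with (a ≟ u) ×-dec (b ≟ v)
      ... | yes a≡u×b≡v = inj₂ a≡u×b≡v
      ... | no ab≢uv    = inj₁
        ( inj₁ (ab , λ ab∈ → ab∉ (⇔-from (∈-∖ {E}) (ab∈ , ab≢uv)))
        , λ { (refl , refl) → D-asym uv ab })
      classify (inj₂ (ba , ba∈)) =
        let ba∈E , ba≢uv = ⇔-to (∈-∖ {E}) ba∈ in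
        inj₁ (inj₂ (ba , ba∈E) , λ { (refl , refl) → ba≢uv (refl , refl) })

      no-detour : ¬ Star Other v u
      no-detour ε = D-irrefl⁺ [ uv ]
      no-detour ((_ , vu≢vu) ◅ ε) = vu≢vu (refl , refl)
      no-detour ((r , _) ◅ s ◅ q) =
        reduction-indecomposable reduced [ r ] (⁺-map proj₁ (s ◅⁺ q))

    restore : ∀ {e} → ReversedInReduction D E e → AcyclicReorientation D
    restore {e} e-reduced = record
      { reversed   = E ∖ e
      ; reversed⊆D = reversed⊆D I ∘ ∖-⊆ {E} {e}
      ; acyclic    = irrefl⁺⇒acyclic (restore-irrefl⁺ e-reduced)
      }

    -- The two sets of reversed arcs differ in a single arc, so anything between them equals one or
    -- the other, depending on whether it contains that arc.
    restore-covered : ∀ {e} (e-reduced : ReversedInReduction D E e) →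
                      Covers (AR D) I (restore e-reduced)
    restore-covered {u , v} e-reduced =
        ( ∖-⊆ {E}
        , λ eq → proj₂ (⇔-to (∈-∖ {E}) (subst (_∋ u ⟶ v) (sym eq) uv∈E)) (refl , refl) )
      , λ { (J , (⊆J , ≢J) , (J⊆ , J≢)) → case reversed J ∋ u ⟶? v of λ where
            (yes uv∈J) → J≢ (arcSet-ext J⊆ λ {a} {b} ab → case (a ≟ u) ×-dec (b ≟ v) of λ where
              (yes (refl , refl)) → uv∈J
              (no ab≢uv)          → ⊆J (⇔-from (∈-∖ {E}) (ab , ab≢uv)))
            (no uv∉J) → ≢J (arcSet-ext ⊆J λ {a} {b} ab →
              ⇔-from (∈-∖ {E}) (J⊆ ab , λ { (refl , refl) → uv∉J ab })) }
      where
      uv∈E : E ∋ u ⟶ v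
      uv∈E = reversedInReduction⇒∈ e-reduced

    -- A path of the reduction of E from b to a, where (a , b) is in E but not
    -- in F, cannot be a path of F, so one of its arcs is not an arc of F.
    reducedInDifference : ∀ (F : AcyclicReorientation D) → reversed F ⊆ᵃ E → reversed F ≢ E →
      ∃[ e ] ReversedInReduction D E e × reversed F ⊆ᵃ (E ∖ e)
    reducedInDifference F F⊆E F≢E
      with any? (λ a → any? (λ b → (E ∋ a ⟶? b) ×-dec ¬? (reversed F ∋ a ⟶? b)))
    ... | no none = contradiction
      (arcSet-ext F⊆E λ {a} {b} ab∈E → decidable-stable (reversed F ∋ a ⟶? b)
        λ ab∉F → none (a , b , ab∈E , ab∉F))
      F≢E
    ... | yes (a , b , ab∈E , ab∉F)
      with ⁺-split (λ {x} {y} _ → reoriented? D (reversed F) x y)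
             (refine [ inj₂ (reversed⊆D I ab∈E , ab∈E) ])
    ... | inj₁ p = contradiction (inj₁ (reversed⊆D I ab∈E , ab∉F) ∷ p)
      (acyclic⇒irrefl⁺ (acyclic F))
    ... | inj₂ (x , y , (inj₁ (xy , xy∉E) , _) , ¬xy) =
      contradiction (inj₁ (xy , xy∉E ∘ F⊆E)) ¬xy
    ... | inj₂ (x , y , t@(inj₂ (yx , yx∈E) , _) , ¬xy) = (y , x) , (yx , t) ,
      λ ab∈F → ⇔-from (∈-∖ {E}) (F⊆E ab∈F , λ { (refl , refl) → ¬xy (inj₂ (yx , ab∈F)) })

    -- If `F` differed from the restoration found by `reducedInDifference`, this restoration would
    -- lie strictly between `F` and `I`. Equality of arc sets is decidable, so the contradiction
    -- yields equality.
    covered⇒restore : ∀ (F : AcyclicReorientation D) → Covers (AR D) I F →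
      ∃[ e ] ReversedInReduction D E e × reversed F ≡ E ∖ e
    covered⇒restore F ((F⊆E , F≢E) , ¬between)
      with e , e-reduced , F⊆E∖e ← reducedInDifference F F⊆E F≢E
      with ≡-dec (≡-dec Bool._≟_) (reversed F) (E ∖ e)
    ... | yes F≡E∖e = e , e-reduced , F≡E∖e
    ... | no F≢E∖e  = ⊥-elim
      (¬between (restore e-reduced , (F⊆E∖e , F≢E∖e) , proj₁ (restore-covered e-reduced)))

    joinIrreducible⇒∃! : JoinIrreducible (AR D) I → ∃! _≡_ (ReversedInReduction D E)
    joinIrreducible⇒∃! (F , covered , unique) =
      let e , e-reduced , F≡E∖e = covered⇒restore F covered in
      e , e-reduced , λ e′-reduced → ∖-injective {E} (reversedInReduction⇒∈ e-reduced)
        (trans (sym F≡E∖e) (unique {restore e′-reduced} (restore-covered e′-reduced)))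

    ∃!⇒joinIrreducible : ∃! _≡_ (ReversedInReduction D E) → JoinIrreducible (AR D) I
    ∃!⇒joinIrreducible (e , e-reduced , unique) =
      restore e-reduced , restore-covered e-reduced , λ {F} covered →
        let e′ , e′-reduced , F≡E∖e′ = covered⇒restore F covered in
        trans (cong (E ∖_) (unique e′-reduced)) (sym F≡E∖e′)

  -- Membership in the sets of arcs and vertices attached to a reorientation or a rope.

  inDifference⇔ : ∀ {E u v} → InDifference D E u v ⇔ (D ∋ u ⟶ v × E ∋ u ⟶ v)
  inDifference⇔ {E} {u} {v} = mk⇔
    (λ (uv , ¬r) → uv , decidable-stable (E ∋ u ⟶? v) λ uv∉ → ¬r (inj₁ (uv , uv∉)))
    -- `u ⟶ v` could reappear only as the reverse of an arc `v ⟶ u`, which `D` does not have.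
    (λ (uv , uv∈) → uv , λ { (inj₁ (_ , uv∉)) → uv∉ uv∈ ; (inj₂ (vu , _)) → D-asym uv vu })

  inIntersection⇔ : ∀ {E u v} → InIntersection D E u v ⇔ Kept E u v
  inIntersection⇔ = mk⇔
    (λ { (_ , inj₁ kept) → kept ; (uv , inj₂ (vu , _)) → contradiction vu (D-asym uv) })
    (λ kept → proj₁ kept , inj₁ kept)

  ∈-∇ : ∀ {E u v w} → w ∈ ∇⟨_,_⟩ D E u v ⇔ ((D ∋ u ⟶ w × E ∋ u ⟶ w) × Kept E w v)
  ∈-∇ {E} {u} {v} = mk⇔
    (λ w∈ → let uw , wv = ⇔-to (∈-subset P?) w∈ in
      ⇔-to (inDifference⇔ {E}) uw , ⇔-to (inIntersection⇔ {E}) wv)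
    (λ (uw , wv) → ⇔-from (∈-subset P?)
      (⇔-from (inDifference⇔ {E}) uw , ⇔-from (inIntersection⇔ {E}) wv))
    where
    P? : U.Decidable (λ w → InDifference D E u w × InIntersection D E w v)
    P? w = inDifference? D E u w ×-dec inIntersection? D E w v

  ∈-Δ : ∀ {E u v w} → w ∈ Δ⟨_,_⟩ D E u v ⇔ (Kept E u w × (D ∋ w ⟶ v × E ∋ w ⟶ v))
  ∈-Δ {E} {u} {v} = mk⇔
    (λ w∈ → let uw , wv = ⇔-to (∈-subset P?) w∈ in
      ⇔-to (inIntersection⇔ {E}) uw , ⇔-to (inDifference⇔ {E}) wv)
    (λ (uw , wv) → ⇔-from (∈-subset P?)
      (⇔-from (inIntersection⇔ {E}) uw , ⇔-from (inDifference⇔ {E}) wv))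
    where
    P? : U.Decidable (λ w → InIntersection D E u w × InDifference D E w v)
    P? w = inIntersection? D E u w ×-dec inDifference? D E w v

  ∈-I∨ : ∀ {u v ∇ Δ w w′} → I∨ D (u , v , ∇ , Δ) ∋ w ⟶ w′ ⇔
         (D ∋ w ⟶ w′ × (w ∈ Δ ⊎ w ≡ u) × (w′ ∈ ∇ ⊎ w′ ≡ v))
  ∈-I∨ {u} {v} {∇} {Δ} = mk⇔
    (λ ww′∈ → let ww′ , w∈ , w′∈ = ⇔-to (∈-arcSet R?) ww′∈ in
      ww′ , ⇔-to ∈-∪⁅⁆ w∈ , ⇔-to ∈-∪⁅⁆ w′∈)
    (λ (ww′ , w∈ , w′∈) → ⇔-from (∈-arcSet R?)
      (ww′ , ⇔-from ∈-∪⁅⁆ w∈ , ⇔-from ∈-∪⁅⁆ w′∈))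
    where
    R? : Decidable (λ w w′ → D ∋ w ⟶ w′ × w ∈ Δ ∪ ⁅ u ⁆ × w′ ∈ ∇ ∪ ⁅ v ⁆)
    R? w w′ = (D ∋ w ⟶? w′) ×-dec ((w ∈? Δ ∪ ⁅ u ⁆) ×-dec (w′ ∈? ∇ ∪ ⁅ v ⁆))

  -- Transitive supports in a filled digraph.

  module JoinIrreduciblesAndRopes (filled : Filled (D ∋_⟶_)) where

    -- The two paths concatenate to a path from `u` to `v` through `w`, on which filledness supplies
    -- all arcs. Every appeal to filledness goes through this lemma.
    filled-interior : ∀ {u v w} → D ∋ u ⟶ v → D⁺ u w → D⁺ w v → D ∋ u ⟶ w × D ∋ w ⟶ v
    filled-interior {u} {v} uv p q
      with xs , path , w∈xs ← path-through p q
      with rs ∷ rss ← filled u xs v path uv =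
      All.lookup rs (interior⁺ xs w∈xs) , allPairs-last (u ∷ xs) (rs ∷ rss) (there w∈xs)

    -- This trades paths of arbitrary length for two arcs, the form in which `∇` and `Δ` of a
    -- reorientation are defined.
    support⇔ : ∀ {u v w} → D ∋ u ⟶ v →
      (TransitiveSupport (D ∋_⟶_) u v w × w ≢ u × w ≢ v) ⇔ (D ∋ u ⟶ w × D ∋ w ⟶ v)
    support⇔ uv = mk⇔
      (λ { ((xs , path , here w≡u) , w≢u , _) → contradiction w≡u w≢u
         ; ((xs , path , there w∈) , _ , w≢v) →
             let w∈xs = interior⁻ xs w∈ w≢v in
             filled-interior uv (path-prefix xs path w∈xs) (path-suffix xs path w∈xs) })
      (λ (uw , wv) → (_ ∷ [] , uw ∷ wv ∷ [-] , there (here refl))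
                   , (λ { refl → D-irrefl⁺ [ uw ] })
                   , (λ { refl → D-irrefl⁺ [ wv ] }))

    -- From a join irreducible to its rope and back.

    module _ (I : AcyclicReorientation D) where

      private
        E = reversed I

      open Irreducibility I

      reduced⇒isRope : ∀ {u v} → ReversedInReduction D E (u , v) →
                       IsRope D (ρ⟨_,_⟩ D E u v)
      reduced⇒isRope {u} {v} (uv , reduced) = uv , disjoint , λ w → mk⇔
          (λ w∈ → ⇔-from (support⇔ uv) (case x∈p∪q⁻ _ _ w∈ of λ where
            (inj₁ w∈∇) → let (uw , _) , (wv , _) = ⇔-to (∈-∇ {E}) w∈∇ in uw , wv
            (inj₂ w∈Δ) → let (uw , _) , (wv , _) = ⇔-to (∈-Δ {E}) w∈Δ in uw , wv))
          (λ w∈ → let uw , wv = ⇔-to (support⇔ uv) w∈ in x∈p∪q⁺ (partition uw wv))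
        where
        disjoint : Empty (∇⟨_,_⟩ D E u v ∩ Δ⟨_,_⟩ D E u v)
        disjoint (w , w∈) with w∈∇ , w∈Δ ← x∈p∩q⁻ _ _ w∈ =
          proj₂ (proj₁ (⇔-to (∈-Δ {E} {u} {v}) w∈Δ))
            (proj₂ (proj₁ (⇔-to (∈-∇ {E} {u} {v}) w∈∇)))

        -- Exactly one of the two arcs is reversed: if both were, `v`, `w`, `u` would be a path
        -- bypassing the reduced arc from `v` to `u`; if neither were, `u`, `w`, `v`, `u` would be a
        -- cycle.
        partition : ∀ {w} → D ∋ u ⟶ w → D ∋ w ⟶ v →
                    w ∈ ∇⟨_,_⟩ D E u v ⊎ w ∈ Δ⟨_,_⟩ D E u v
        partition {w} uw wv with E ∋ u ⟶? w | E ∋ w ⟶? v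
        ... | yes uw∈ | no wv∉  = inj₁ (⇔-from (∈-∇ {E}) ((uw , uw∈) , (wv , wv∉)))
        ... | no uw∉  | yes wv∈ = inj₂ (⇔-from (∈-Δ {E}) ((uw , uw∉) , (wv , wv∈)))
        ... | yes uw∈ | yes wv∈ = ⊥-elim
          (reduction-indecomposable reduced [ inj₂ (wv , wv∈) ] [ inj₂ (uw , uw∈) ])
        ... | no uw∉  | no wv∉  = ⊥-elim
          (irrefl⁺ (inj₁ (uw , uw∉) ∷ inj₁ (wv , wv∉) ∷ [ proj₁ reduced ]))

      -- If w ⟶ w′ is reversed, then a path from w′ to w in the reduction of E
      -- must use the only reversed arc there: it goes from w′ to v and from u
      -- to w along arcs of D, so w and w′ lie on a path of D from u to v.
      I∨-ρ∨ : (unique : ∃! _≡_ (ReversedInReduction D E)) → I∨ D (ρ∨ D E unique) ≡ E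
      I∨-ρ∨ ((u , v) , (uv , reduced) , unique) = arcSet-ext backward forward
        where
        v⇒u : Reoriented D E v u
        v⇒u = proj₁ reduced

        -- If `w ⟶ w′` were kept, it would close a cycle: from `w′` a kept arc, or nothing, leads to
        -- `v`, and from `v` a reversed arc leads to `w`.
        backward : I∨ D (ρ⟨_,_⟩ D E u v) ⊆ᵃ E
        backward {w} {w′} ww′∈I with ww′ , w∈ , w′∈ ← ⇔-to (∈-I∨ {u} {v}) ww′∈I =
          decidable-stable (E ∋ w ⟶? w′) λ ww′∉ →
            irrefl⁺ (inj₁ (ww′ , ww′∉) ∷ (w′⇒*v w′∈ ◅◅⁺ v⇒⁺w w∈))
          where
          w′⇒*v : w′ ∈ ∇⟨_,_⟩ D E u v ⊎ w′ ≡ v → Star (Reoriented D E) w′ v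
          w′⇒*v (inj₁ w′∈∇) = inj₁ (proj₂ (⇔-to (∈-∇ {E}) w′∈∇)) ◅ ε
          w′⇒*v (inj₂ refl) = ε

          v⇒⁺w : w ∈ Δ⟨_,_⟩ D E u v ⊎ w ≡ u → TransClosure (Reoriented D E) v w
          v⇒⁺w (inj₁ w∈Δ)  = [ inj₂ (proj₂ (⇔-to (∈-Δ {E}) w∈Δ)) ]
          v⇒⁺w (inj₂ refl) = [ v⇒u ]

        forward : E ⊆ᵃ I∨ D (ρ⟨_,_⟩ D E u v)
        forward {w} {w′} ww′∈E =
          case detour classify (refine [ inj₂ (ww′ , ww′∈E) ]) of λ where
            (inj₁ p)       → ⊥-elim (D-irrefl⁺ (ww′ ∷ kept⁺⇒D⁺ {E} p))
            (inj₂ (p , q)) → ⇔-from ∈-I∨ (ww′ , tail q (ww′ ◅⁺ D* p) , head p (D* q ◅◅⁺ [ ww′ ]))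
          where
          ww′ : D ∋ w ⟶ w′
          ww′ = reversed⊆D I ww′∈E

          D* : ∀ {x y} → Star (Kept E) x y → Star (D ∋_⟶_) x y
          D* = Star.map proj₁

          ⇒* : ∀ {x y} → Star (Kept E) x y → Star (Reoriented D E) x y
          ⇒* = Star.map inj₁

          classify : ∀ {x y} → TransitiveReduction (Reoriented D E) x y →
                     Kept E x y ⊎ (x ≡ v × y ≡ u)
          classify (inj₁ kept , _) = inj₁ kept
          classify t@(inj₂ (yx , _) , _) with refl ← unique (yx , t) = inj₂ (refl , refl)

          -- When `w` differs from `u`, both arcs at `w` exist by filledness. Reversing `u ⟶ w`
          -- would close a cycle with the path `q`, and keeping `w ⟶ v` would close one through `v`,
          -- `u` and `q`. The argument for `head` is symmetric.
          tail : Star (Kept E) u w → D⁺ w v → w ∈ Δ⟨_,_⟩ D E u v ⊎ w ≡ u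
          tail q w⇝v = case *⇒≡⊎⁺ q of λ where
            (inj₁ refl) → inj₂ refl
            (inj₂ q⁺)   →
              let uw , wv = filled-interior uv (kept⁺⇒D⁺ {E} q⁺) w⇝v in
              inj₁ (⇔-from (∈-Δ {E})
                ( (uw , λ uw∈ → irrefl⁺ (inj₂ (uw , uw∈) ◅⁺ ⇒* q))
                , (wv , decidable-stable (E ∋ w ⟶? v) λ wv∉ →
                          irrefl⁺ (inj₁ (wv , wv∉) ∷ (v⇒u ◅⁺ ⇒* q))) ))

          head : Star (Kept E) w′ v → D⁺ u w′ → w′ ∈ ∇⟨_,_⟩ D E u v ⊎ w′ ≡ v
          head p u⇝w′ = case *⇒≡⊎⁺ p of λ where
            (inj₁ refl) → inj₂ refl
            (inj₂ p⁺)   →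
              let uw′ , w′v = filled-interior uv u⇝w′ (kept⁺⇒D⁺ {E} p⁺) in
              inj₁ (⇔-from (∈-∇ {E})
                ( (uw′ , decidable-stable (E ∋ u ⟶? w′) λ uw′∉ →
                           irrefl⁺ (inj₁ (uw′ , uw′∉) ∷ (⇒* p ◅◅⁺ [ v⇒u ])))
                , (w′v , λ w′v∈ → irrefl⁺ (inj₂ (w′v , w′v∈) ◅⁺ ⇒* p)) ))

    -- From a rope to its join irreducible and back.

    module _ {u v : Fin n} {∇ Δ : Subset n} (isRope : IsRope D (u , v , ∇ , Δ)) where

      private
        uv = proj₁ isRope
        ∇∩Δ=∅ = proj₁ (proj₂ isRope)

        E = I∨ D (u , v , ∇ , Δ)

        -- Two disjoint classes that together contain every vertex on a path of `D` from `u` to `v`;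
        -- the reversed arcs are those leading from the first class to the second.
        Tail Head : U.Pred (Fin n) 0ℓ
        Tail w = w ∈ Δ ⊎ w ≡ u
        Head w = w ∈ ∇ ⊎ w ≡ v

      interior⇔ : ∀ {w} → w ∈ ∇ ∪ Δ ⇔ (D ∋ u ⟶ w × D ∋ w ⟶ v)
      interior⇔ {w} = mk⇔
        (⇔-to (support⇔ uv) ∘ ⇔-to (proj₂ (proj₂ isRope) w))
        (⇔-from (proj₂ (proj₂ isRope) w) ∘ ⇔-from (support⇔ uv))

      ∇⇒interior : ∀ {w} → w ∈ ∇ → D ∋ u ⟶ w × D ∋ w ⟶ v
      ∇⇒interior w∈∇ = ⇔-to interior⇔ (x∈p∪q⁺ (inj₁ w∈∇))

      Δ⇒interior : ∀ {w} → w ∈ Δ → D ∋ u ⟶ w × D ∋ w ⟶ v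
      Δ⇒interior w∈Δ = ⇔-to interior⇔ (x∈p∪q⁺ (inj₂ w∈Δ))

      u⇝tail : ∀ {w} → Tail w → Star (D ∋_⟶_) u w
      u⇝tail (inj₁ w∈Δ)  = proj₁ (Δ⇒interior w∈Δ) ◅ ε
      u⇝tail (inj₂ refl) = ε

      head⇝v : ∀ {w} → Head w → Star (D ∋_⟶_) w v
      head⇝v (inj₁ w∈∇)  = proj₂ (∇⇒interior w∈∇) ◅ ε
      head⇝v (inj₂ refl) = ε

      tail⟶v : ∀ {w} → Tail w → D ∋ w ⟶ v
      tail⟶v (inj₁ w∈Δ)  = proj₂ (Δ⇒interior w∈Δ)
      tail⟶v (inj₂ refl) = uv

      -- For interior vertices this is the disjointness of `∇` and `Δ`; at the endpoints, `v` as a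
      -- tail or `u` in `∇` would produce a loop of `D`.
      ¬tail×head : ∀ {w} → Tail w → ¬ Head w
      ¬tail×head (inj₁ w∈Δ)  (inj₁ w∈∇)  = ∇∩Δ=∅ (_ , x∈p∩q⁺ (w∈∇ , w∈Δ))
      ¬tail×head tail        (inj₂ refl) = D-irrefl⁺ [ tail⟶v tail ]
      ¬tail×head (inj₂ refl) (inj₁ u∈∇)  = D-irrefl⁺ [ proj₁ (∇⇒interior u∈∇) ]

      interior⇒tail⊎head : ∀ {w} → D⁺ u w → D⁺ w v → Tail w ⊎ Head w
      interior⇒tail⊎head p q =
        case x∈p∪q⁻ ∇ Δ (⇔-from interior⇔ (filled-interior uv p q)) of λ where
          (inj₁ w∈∇) → inj₂ (inj₁ w∈∇)
          (inj₂ w∈Δ) → inj₁ (inj₁ w∈Δ)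

      -- All vertices of the path lie on a path of D from u to v, hence each is
      -- in ∇ ∪ {v} or in Δ ∪ {u}; the arc leaving Δ ∪ {u} is reversed.
      no-kept-tail⇝head : ∀ {a b} → Tail a → Head b → ¬ TransClosure (Kept E) a b
      no-kept-tail⇝head a-tail b-head [ ab , ab∉ ] =
        ab∉ (⇔-from ∈-I∨ (ab , a-tail , b-head))
      no-kept-tail⇝head a-tail b-head ((ac , ac∉) ∷ p) =
        case interior⇒tail⊎head (u⇝tail a-tail ◅◅⁺ [ ac ])
                                (kept⁺⇒D⁺ {E} p ⁺◅◅ head⇝v b-head) of λ where
          (inj₁ c-tail) → no-kept-tail⇝head c-tail b-head p
          (inj₂ c-head) → ac∉ (⇔-from ∈-I∨ (ac , a-tail , c-head))

      no-kept*-tail⇝head : ∀ {a b} → Tail a → Head b → ¬ Star (Kept E) a b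
      no-kept*-tail⇝head a-tail b-head p = case *⇒≡⊎⁺ p of λ where
        (inj₁ refl) → ¬tail×head a-tail b-head
        (inj₂ p⁺)   → no-kept-tail⇝head a-tail b-head p⁺

      -- A reversed arc is traversed from a head `b` to a tail `a`. Between two consecutive ones
      -- there would be a kept path from a tail to a head, which cannot exist. Only the kept pieces
      -- before and after the arc are recorded, since later arguments close them up.
      reversed-at-most-once : ∀ {x y} → TransClosure (Reoriented D E) x y →
        TransClosure (Kept E) x y ⊎
        ∃[ a ] ∃[ b ] Tail a × Head b × Star (Kept E) x b × Star (Kept E) a y
      reversed-at-most-once [ inj₁ kept ] = inj₁ [ kept ]
      reversed-at-most-once [ inj₂ (_ , yx∈) ] =
        let _ , y-tail , x-head = ⇔-to ∈-I∨ yx∈ in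
        inj₂ (_ , _ , y-tail , x-head , ε , ε)
      reversed-at-most-once (inj₁ kept ∷ p) = case reversed-at-most-once p of λ where
        (inj₁ q) → inj₁ (kept ∷ q)
        (inj₂ (_ , _ , a-tail , b-head , q , t)) →
          inj₂ (_ , _ , a-tail , b-head , kept ◅ q , t)
      reversed-at-most-once (inj₂ (_ , zx∈) ∷ p)
        with _ , z-tail , x-head ← ⇔-to ∈-I∨ zx∈ = case reversed-at-most-once p of λ where
          (inj₁ q) → inj₂ (_ , _ , z-tail , x-head , ε , ⁺⇒* q)
          (inj₂ (_ , _ , _ , b-head , q , _)) → ⊥-elim (no-kept*-tail⇝head z-tail b-head q)

      -- A cycle with a reversed arc becomes, when that arc is cut out, a kept path from its tail to
      -- its head.
      I∨-irrefl⁺ : ∀ {x} → ¬ TransClosure (Reoriented D E) x x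
      I∨-irrefl⁺ p = case reversed-at-most-once p of λ where
        (inj₁ q) → D-irrefl⁺ (kept⁺⇒D⁺ {E} q)
        (inj₂ (_ , _ , a-tail , b-head , q , t)) →
          no-kept*-tail⇝head a-tail b-head (t ◅◅ q)

      I∨-reorientation : AcyclicReorientation D
      I∨-reorientation = record
        { reversed   = E
        ; reversed⊆D = λ ab∈ → proj₁ (⇔-to ∈-I∨ ab∈)
        ; acyclic    = irrefl⁺⇒acyclic I∨-irrefl⁺
        }

      uv∈I∨ : E ∋ u ⟶ v
      uv∈I∨ = ⇔-from ∈-I∨ (uv , inj₂ refl , inj₂ refl)

      -- If a detour from `v` to `u` starts with a kept arc, then it returns to `v` inside `D`,
      -- either through a head or through `u ⟶ v`. If it starts with a reversed arc, it arrives at a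
      -- tail, from which kept arcs reach neither a head nor `u`.
      uv-reduced : ReversedInReduction D E (u , v)
      uv-reduced = uv , indecomposable⇒reduction (inj₂ (uv , uv∈I∨)) ¬split
        where
        ¬split : ∀ {w} → Reoriented D E v w → ¬ TransClosure (Reoriented D E) w u
        ¬split (inj₁ (vw , _)) p = case reversed-at-most-once p of λ where
          (inj₁ q) → D-irrefl⁺ (uv ∷ vw ∷ kept⁺⇒D⁺ {E} q)
          (inj₂ (_ , _ , _ , b-head , q , _)) →
            D-irrefl⁺ (vw ◅⁺ (Star.map proj₁ q ◅◅ head⇝v b-head))
        ¬split (inj₂ (_ , wv∈)) p
          with _ , w-tail , _ ← ⇔-to ∈-I∨ wv∈ = case reversed-at-most-once p of λ where
            (inj₁ q) → D-irrefl⁺ (kept⁺⇒D⁺ {E} q ⁺◅◅ u⇝tail w-tail)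
            (inj₂ (_ , _ , _ , b-head , q , _)) → no-kept*-tail⇝head w-tail b-head q

      -- For a reversed arc a ⟶ b other than u ⟶ v, the path b ⇒ a is shortcut
      -- through v if b ≠ v, and through u if a ≠ u.
      uv-unique : ∀ {e} → ReversedInReduction D E e → (u , v) ≡ e
      uv-unique {a , b} (ab , reduced)
        with ab∈ ← Irreducibility.reversedInReduction⇒∈ I∨-reorientation (ab , reduced)
        with _ , a-tail , b-head ← ⇔-to ∈-I∨ ab∈
        with a-tail | b-head
      ... | inj₂ refl | inj₂ refl = refl
      ... | _         | inj₁ b∈∇  = ⊥-elim (reduction-indecomposable reduced
        [ inj₁ ( proj₂ (∇⇒interior b∈∇)
               , λ bv∈ → ¬tail×head (proj₁ (proj₂ (⇔-to ∈-I∨ bv∈))) (inj₁ b∈∇)) ]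
        [ inj₂ (tail⟶v a-tail , ⇔-from ∈-I∨ (tail⟶v a-tail , a-tail , inj₂ refl)) ])
      ... | inj₁ a∈Δ  | inj₂ refl = ⊥-elim (reduction-indecomposable reduced
        [ inj₂ (uv , uv∈I∨) ]
        [ inj₁ ( proj₁ (Δ⇒interior a∈Δ)
               , λ ua∈ → ¬tail×head (inj₁ a∈Δ) (proj₂ (proj₂ (⇔-to ∈-I∨ ua∈)))) ])

      I∨-unique : ∃! _≡_ (ReversedInReduction D E)
      I∨-unique = (u , v) , uv-reduced , uv-unique

      -- If `u ⟶ w` is reversed then `w` is a head, and it is not `v` because `w ⟶ v` is an arc.
      -- Conversely, for `w` in `∇` the arc `w ⟶ v` is kept because `w` is no tail. The second
      -- component is treated symmetrically.
      ρ∨-I∨ : ρ⟨_,_⟩ D E u v ≡ (u , v , ∇ , Δ)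
      ρ∨-I∨ = cong₂ (λ S T → u , v , S , T)
        (subset-ext (mk⇔
          (λ w∈ → let (_ , uw∈) , wv , _ = ⇔-to (∈-∇ {E} {u} {v}) w∈ in
                  case proj₂ (proj₂ (⇔-to (∈-I∨ {u} {v} {∇} {Δ}) uw∈)) of λ where
                    (inj₁ w∈∇)  → w∈∇
                    (inj₂ refl) → ⊥-elim (D-irrefl⁺ [ wv ]))
          (λ w∈∇ → let uw , wv = ∇⇒interior w∈∇ in
                   ⇔-from (∈-∇ {E})
                     ( (uw , ⇔-from ∈-I∨ (uw , inj₂ refl , inj₁ w∈∇))
                     , (wv , λ wv∈ → ¬tail×head (proj₁ (proj₂ (⇔-to ∈-I∨ wv∈))) (inj₁ w∈∇))))))
        (subset-ext (mk⇔
          (λ w∈ → let (uw , _) , _ , wv∈ = ⇔-to (∈-Δ {E} {u} {v}) w∈ in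
                  case proj₁ (proj₂ (⇔-to (∈-I∨ {u} {v} {∇} {Δ}) wv∈)) of λ where
                    (inj₁ w∈Δ)  → w∈Δ
                    (inj₂ refl) → ⊥-elim (D-irrefl⁺ [ uw ]))
          (λ w∈Δ → let uw , wv = Δ⇒interior w∈Δ in
                   ⇔-from (∈-Δ {E})
                     ( (uw , λ uw∈ → ¬tail×head (inj₁ w∈Δ) (proj₂ (proj₂ (⇔-to ∈-I∨ uw∈))))
                     , (wv , ⇔-from ∈-I∨ (wv , inj₁ w∈Δ , inj₂ refl))))))

    -- Equality of irreducibles compares only the reversed arcs, so the rope must not depend on the
    -- chosen proof of unique existence; uniqueness identifies the two arcs.
    ρ∨-cong : ∀ {E F} → E ≡ F →
      (p : ∃! _≡_ (ReversedInReduction D E)) (q : ∃! _≡_ (ReversedInReduction D F)) →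
      ρ∨ D E p ≡ ρ∨ D F q
    ρ∨-cong refl ((u , v) , _ , unique) (_ , reduced , _) with refl ← unique reduced = refl

    joinIrreducibles↔ropes : Inverse (JoinIrreducibles D) (Ropes D)
    joinIrreducibles↔ropes = record
      { to        = λ (I , irr) → let unique@(_ , reduced , _) = unique-arc I irr in
                      ρ∨ D (reversed I) unique , reduced⇒isRope I reduced
      ; from      = λ (_ , isRope) → I∨-reorientation isRope ,
                      Irreducibility.∃!⇒joinIrreducible (I∨-reorientation isRope) (I∨-unique isRope)
      ; to-cong   = λ { {I , irr} {J , irr′} I≡J →
                        ρ∨-cong I≡J (unique-arc I irr) (unique-arc J irr′) }
      ; from-cong = cong (I∨ D)
      ; inverse   =
          (λ { {ρ , isRope} {I , irr} I≡I∨ →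
               trans (ρ∨-cong I≡I∨ (unique-arc I irr) (I∨-unique isRope)) (ρ∨-I∨ isRope) })
        , (λ { {I , irr} ρ≡ρ∨ →
               trans (cong (I∨ D) ρ≡ρ∨) (I∨-ρ∨ I (unique-arc I irr)) })
      }
      where
      unique-arc : ∀ I → JoinIrreducible (AR D) I →
                   ∃! _≡_ (ReversedInReduction D (reversed I))
      unique-arc I = Irreducibility.joinIrreducible⇒∃! I

    givenBy-ρ∨-I∨ : GivenBy-ρ∨-I∨ D joinIrreducibles↔ropes
    givenBy-ρ∨-I∨ =
      (λ (I , irr) → Irreducibility.joinIrreducible⇒∃! I irr , refl) , (λ _ → refl)

  -- Complementation and the transfer to meet irreducibles.

  complement : ArcSet n → ArcSet n
  complement E = arcSet λ u v → (D ∋ u ⟶? v) ×-dec ¬? (E ∋ u ⟶? v)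

  ∈-complement : ∀ {E u v} → complement E ∋ u ⟶ v ⇔ Kept E u v
  ∈-complement {E} = ∈-arcSet λ u v → (D ∋ u ⟶? v) ×-dec ¬? (E ∋ u ⟶? v)

  kept-complement : ∀ {E u v} → Kept (complement E) u v ⇔ (D ∋ u ⟶ v × E ∋ u ⟶ v)
  kept-complement {E} {u} {v} = mk⇔
    (λ (uv , uv∉) → uv , decidable-stable (E ∋ u ⟶? v) λ uv∉E →
      uv∉ (⇔-from (∈-complement {E}) (uv , uv∉E)))
    (λ (uv , uv∈E) → uv , λ uv∈ → proj₂ (⇔-to (∈-complement {E}) uv∈) uv∈E)

  reversed-complement : ∀ {E u v} →
    (D ∋ u ⟶ v × complement E ∋ u ⟶ v) ⇔ Kept E u v
  reversed-complement {E} = mk⇔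
    (⇔-to (∈-complement {E}) ∘ proj₂)
    (λ kept → proj₁ kept , ⇔-from (∈-complement {E}) kept)

  -- Complementing exchanges kept and reversed arcs, hence the two summands of `Reoriented`.
  -- Acyclicity and reductions are thereby carried over to the opposite relation.
  reoriented-complement : ∀ {E u v} →
    Reoriented D (complement E) u v ⇔ Reoriented D E v u
  reoriented-complement {E} = mk⇔
    Sum.[ inj₂ ∘ ⇔-to (kept-complement {E}) , inj₁ ∘ ⇔-to (reversed-complement {E}) ]
    Sum.[ inj₂ ∘ ⇔-from (reversed-complement {E}) , inj₁ ∘ ⇔-from (kept-complement {E}) ]

  complement-involutive : ∀ {E} → E ⊆ᵃ D → complement (complement E) ≡ E
  complement-involutive {E} E⊆D = arcSet-ext
    (λ uv∈ → proj₂ (⇔-to (kept-complement {E}) (⇔-to (∈-complement {complement E}) uv∈)))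
    (λ uv∈ → ⇔-from (∈-complement {complement E})
               (⇔-from (kept-complement {E}) (E⊆D uv∈ , uv∈)))

  opposite : AcyclicReorientation D → AcyclicReorientation D
  opposite I = record
    { reversed   = complement (reversed I)
    ; reversed⊆D = proj₁ ∘ ⇔-to (∈-complement {reversed I})
    ; acyclic    = irrefl⁺⇒acyclic λ p → acyclic⇒irrefl⁺ (acyclic I)
        (⁺-reverse (⇔-to (reoriented-complement {reversed I})) p)
    }

  opposite-antitone : ∀ {I J} → reversed I ⊆ᵃ reversed J →
                      reversed (opposite J) ⊆ᵃ reversed (opposite I)
  opposite-antitone {I} {J} I⊆J uv∈ =
    let uv , uv∉J = ⇔-to (∈-complement {reversed J}) uv∈ in
    ⇔-from (∈-complement {reversed I}) (uv , uv∉J ∘ I⊆J)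

  opposite-involutive : ∀ I → reversed (opposite (opposite I)) ≡ reversed I
  opposite-involutive I = complement-involutive (reversed⊆D I)

  open AntitoneInvolution (AR D) opposite
    (λ {I} {J} → opposite-antitone {I} {J}) opposite-involutive

  meetIrreducibles↔joinIrreducibles : Inverse (MeetIrreducibles D) (JoinIrreducibles D)
  meetIrreducibles↔joinIrreducibles = record
    { to        = λ (I , irr) → opposite I , meet⇒joinIrreducible {I} irr
    ; from      = λ (I , irr) → opposite I , join⇒meetIrreducible {I} irr
    ; to-cong   = cong complement
    ; from-cong = cong complement
    ; inverse   = (λ { {I , _} eq → trans (cong complement eq) (opposite-involutive I) })
                , (λ { {I , _} eq → trans (cong complement eq) (opposite-involutive I) })
    }

  swap : Quadruple n → Quadruple n
  swap (u , v , ∇ , Δ) = u , v , Δ , ∇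

  swap-isRope : ∀ ρ → IsRope D ρ → IsRope D (swap ρ)
  swap-isRope (_ , _ , ∇ , Δ) (uv , disjoint , partition) =
    uv , subst Empty (∩-comm ∇ Δ) disjoint ,
    λ w → subst (λ S → w ∈ S ⇔ _) (∪-comm ∇ Δ) (partition w)

  ropes↔ropes : Inverse (Ropes D) (Ropes D)
  ropes↔ropes = record
    { to        = λ (ρ , isRope) → swap ρ , swap-isRope ρ isRope
    ; from      = λ (ρ , isRope) → swap ρ , swap-isRope ρ isRope
    ; to-cong   = cong swap
    ; from-cong = cong swap
    ; inverse   = cong swap , cong swap
    }

  unreversed⇔reversed-complement : ∀ {E e} →
    UnreversedInReduction D E e ⇔ ReversedInReduction D (complement E) e
  unreversed⇔reversed-complement {E} = mk⇔
    (λ (uv , t) → uv , transitiveReduction-reverse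
      (mk⇔ (⇔-from (reoriented-complement {E})) (⇔-to (reoriented-complement {E}))) t)
    (λ (uv , t) → uv , transitiveReduction-reverse (reoriented-complement {E}) t)

  -- The conditions defining `∇` and `Δ` differ only in which of the two arcs at `w` is reversed, so
  -- exchanging kept and reversed arcs exchanges them.
  swap-ρ-complement : ∀ {E} u v → swap (ρ⟨_,_⟩ D (complement E) u v) ≡ ρ⟨_,_⟩ D E u v
  swap-ρ-complement {E} u v = cong₂ (λ S T → u , v , S , T)
    (subset-ext (mk⇔
      (λ w∈ → let uw , wv = ⇔-to (∈-Δ {complement E} {u} {v}) w∈ in ⇔-from (∈-∇ {E})
        (⇔-to (kept-complement {E}) uw , ⇔-to (reversed-complement {E}) wv))
      (λ w∈ → let uw , wv = ⇔-to (∈-∇ {E} {u} {v}) w∈ in ⇔-from (∈-Δ {complement E})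
        (⇔-from (kept-complement {E}) uw , ⇔-from (reversed-complement {E}) wv))))
    (subset-ext (mk⇔
      (λ w∈ → let uw , wv = ⇔-to (∈-∇ {complement E} {u} {v}) w∈ in ⇔-from (∈-Δ {E})
        (⇔-to (reversed-complement {E}) uw , ⇔-to (kept-complement {E}) wv))
      (λ w∈ → let uw , wv = ⇔-to (∈-Δ {E} {u} {v}) w∈ in ⇔-from (∈-∇ {complement E})
        (⇔-from (reversed-complement {E}) uw , ⇔-from (kept-complement {E}) wv))))

  -- After the swap, `I∨` reverses the arcs from `∇ ∪ ⁅ u ⁆` to `Δ ∪ ⁅ v ⁆`, which are precisely
  -- those that `I∧` leaves alone.
  complement-I∨-swap : ∀ ρ → complement (I∨ D (swap ρ)) ≡ I∧ D ρ
  complement-I∨-swap (u , v , ∇ , Δ) = arcSet-ext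
    (λ ab∈ → let ab , ab∉ = ⇔-to (∈-complement {I∨ D (u , v , Δ , ∇)}) ab∈ in
             ⇔-from (∈-arcSet I∧?) (ab , λ in× → ab∉ (⇔-from (∈-arcSet I∨?) (ab , in×))))
    (λ ab∈ → let ab , ¬in× = ⇔-to (∈-arcSet I∧?) ab∈ in
             ⇔-from (∈-complement {I∨ D (u , v , Δ , ∇)})
               (ab , λ ab∈I∨ → ¬in× (proj₂ (⇔-to (∈-arcSet I∨?) ab∈I∨))))
    where
    In× : Rel (Fin n) 0ℓ
    In× a b = a ∈ ∇ ∪ ⁅ u ⁆ × b ∈ Δ ∪ ⁅ v ⁆

    in×? : Decidable In×
    in×? a b = (a ∈? ∇ ∪ ⁅ u ⁆) ×-dec (b ∈? Δ ∪ ⁅ v ⁆)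

    I∨? : Decidable (λ a b → D ∋ a ⟶ b × In× a b)
    I∨? a b = (D ∋ a ⟶? b) ×-dec in×? a b

    I∧? : Decidable (λ a b → D ∋ a ⟶ b × ¬ In× a b)
    I∧? a b = (D ∋ a ⟶? b) ×-dec ¬? (in×? a b)

  meetIrreducibles↔ropes : Inverse (JoinIrreducibles D) (Ropes D) →
                           Inverse (MeetIrreducibles D) (Ropes D)
  meetIrreducibles↔ropes f =
    Composition.inverse meetIrreducibles↔joinIrreducibles (Composition.inverse f ropes↔ropes)

  -- The distinguished arc `(u , v)` of `D` stays the same: it is reversed in the reduction of the
  -- opposite reorientation exactly when it is unreversed in the original one.
  givenBy-ρ∧-I∧ : ∀ f → GivenBy-ρ∨-I∨ D f → GivenBy-ρ∧-I∧ D (meetIrreducibles↔ropes f)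
  givenBy-ρ∧-I∧ f (to-f , from-f) = to-meet , λ (ρ , isRope) →
      trans (cong complement (from-f (swap ρ , swap-isRope ρ isRope))) (complement-I∨-swap ρ)
    where
    to-meet : ∀ I → Σ[ arc ∈ ∃! _≡_ (UnreversedInReduction D (reversed (proj₁ I))) ]
      proj₁ (Inverse.to (meetIrreducibles↔ropes f) I) ≡ ρ∧ D (reversed (proj₁ I)) arc
    to-meet (I , irr) =
      let ((u , v) , reduced , unique) , eq = to-f (opposite I , meet⇒joinIrreducible {I} irr) in
      ( (u , v) , ⇔-from (unreversed⇔reversed-complement {reversed I}) reduced
      , unique ∘ ⇔-to (unreversed⇔reversed-complement {reversed I}) )
      , trans (cong swap eq) (swap-ρ-complement {reversed I} u v)

proposition28 : (n : ℕ) (D : Digraph n) → Acyclic (D ∋_⟶_) → Skeletal (D ∋_⟶_) →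
    Σ (Inverse (JoinIrreducibles D) (Ropes D)) (GivenBy-ρ∨-I∨ D) × Σ (Inverse (MeetIrreducibles D) (Ropes D)) (GivenBy-ρ∧-I∧ D)
proposition28 n D D-acyclic (_ , filled) =
    (joinIrreducibles↔ropes , givenBy-ρ∨-I∨)
  , (meetIrreducibles↔ropes joinIrreducibles↔ropes ,
     givenBy-ρ∧-I∧ joinIrreducibles↔ropes givenBy-ρ∨-I∨)
  where
  open AcyclicReorientations D D-acyclic
  open JoinIrreduciblesAndRopes filled
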